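{- Let $G$ be a finite graph with chromatic number $3$. Then $\theta(G)=1$ if and only if $\chi_c(G)=3$.
   Context: For a positive integer $k$, $G^{k}$ has vertex set $V(G)$, with $u,v$ adjacent iff there is a walk of length $k$ between them in $G$. $S_t(G)$ replaces each edge by a path with exactly $t-1$ inner vertices, and $G^{\frac{2r+1}{2s+1}}:=(S_{2s+1}(G))^{2r+1}$ for non-negative integers $r,s$. $og(G)$ is the odd girth. For a non-bipartite graph $G$, $\theta(G):=\sup\{\frac{2r+1}{2s+1}: r,s\ge 0 \text{ integers},\ \chi(G^{\frac{2r+1}{2s+1}})\le\chi(G),\ \frac{2r+1}{2s+1}<og(G)\}$. For integers $n\ge 2d\ge 2$, $K_{n/d}$ has vertices $v_0,\ldots,v_{n-1}$ with $v_iv_j$ an edge iff $d\le|i-j|\le n-d$; the circular chromatic number $\chi_c(G)$ is the minimum of $n/d$ such that $G$ has a homomorphism to $K_{n/d}$. -}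

module Defs where

open import Data.Nat using (ℕ; zero; suc; _+_; _*_; _∸_; _≤_; _<_; ∣_-_∣)
open import Data.Fin using (Fin; toℕ)
open import Data.Bool using (Bool; true; false)
open import Data.Sum using (_⊎_; inj₁; inj₂)
open import Data.Product using (Σ; _×_; ∃; ∃-syntax; _,_)
open import Relation.Binary.PropositionalEquality using (_≡_; _≢_)
open import Function.Definitions using (Injective)

record Graph : Set₁ where
  field
    V   : Set
    Adj : V → V → Set
open Graph public

data Walk (G : Graph) : ℕ → V G → V G → Set where
  nil  : ∀ {x} → Walk G 0 x x
  cons : ∀ {k x y z} → Adj G x y → Walk G k y z → Walk G (suc k) x z

Power : Graph → ℕ → Graph
Power G k = record { V = V G ; Adj = λ u v → Walk G k u v }

Colourable : Graph → ℕ → Set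
Colourable G k = Σ (V G → Fin k) λ c → ∀ x y → Adj G x y → c x ≢ c y

ChromaticNumberIs : Graph → ℕ → Set
ChromaticNumberIs G k = Colourable G k × (∀ m → Colourable G m → k ≤ m)

ChiLe : Graph → Graph → Set
ChiLe H G = ∃[ k ] (ChromaticNumberIs G k × Colourable H k)

Hom : Graph → Graph → Set
Hom G H = Σ (V G → V H) λ f → ∀ x y → Adj G x y → Adj H (f x) (f y)

CircK : ℕ → ℕ → Graph
CircK n d = record { V = Fin n
                   ; Adj = λ i j → d ≤ ∣ toℕ i - toℕ j ∣ × ∣ toℕ i - toℕ j ∣ ≤ n ∸ d }

-- χ_c(G) = p/q : the minimum of n/d over n ≥ 2d ≥ 2 with G → K_{n/d}
CircChiIs : Graph → ℕ → ℕ → Set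
CircChiIs G p q =
  (∃[ n ] ∃[ d ] (1 ≤ d × 2 * d ≤ n × n * q ≡ p * d × Hom G (CircK n d)))
  × (∀ n d → 1 ≤ d → 2 * d ≤ n → Hom G (CircK n d) → p * d ≤ n * q)

Odd : ℕ → Set
Odd ℓ = ∃[ k ] ℓ ≡ suc (2 * k)

HasCycle : Graph → ℕ → Set
HasCycle G ℓ = 3 ≤ ℓ × Σ (Fin ℓ → V G) λ c →
  Injective _≡_ _≡_ c ×
  (∀ i j → (suc (toℕ i) ≡ toℕ j ⊎ (suc (toℕ i) ≡ ℓ × toℕ j ≡ 0)) → Adj G (c i) (c j))

OddGirthIs : Graph → ℕ → Set
OddGirthIs G g = Odd g × HasCycle G g × (∀ ℓ → Odd ℓ → HasCycle G ℓ → g ≤ ℓ)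

record SimpleGraph (n : ℕ) : Set where
  field
    E      : Fin n → Fin n → Bool
    sym    : ∀ u v → E u v ≡ E v u
    irrefl : ∀ u → E u u ≡ false
open SimpleGraph public

toGraph : ∀ {n} → SimpleGraph n → Graph
toGraph {n} G = record { V = Fin n ; Adj = λ u v → E G u v ≡ true }

-- inner vertices of the subdivision S_t(G): each edge {u,v} (stored once,
-- with u < v) carries t-1 inner vertices indexed 0..t-2 along the path u → v
record Inner {n : ℕ} (G : SimpleGraph n) (t : ℕ) : Set where
  constructor inner
  field
    eu  : Fin n
    ev  : Fin n
    lt  : toℕ eu < toℕ ev
    isE : E G eu ev ≡ true
    pos : Fin (t ∸ 1)
open Inner public

EndAdj : ∀ {n} {G : SimpleGraph n} {t} → Fin n → Inner G t → Set
EndAdj {t = t} a x = (a ≡ eu x × toℕ (pos x) ≡ 0) ⊎ (a ≡ ev x × suc (toℕ (pos x)) ≡ t ∸ 1)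

SubAdj : ∀ {n} (G : SimpleGraph n) (t : ℕ) → Fin n ⊎ Inner G t → Fin n ⊎ Inner G t → Set
SubAdj G t (inj₁ a) (inj₁ b) = t ≡ 1 × E G a b ≡ true
SubAdj G t (inj₁ a) (inj₂ x) = EndAdj a x
SubAdj G t (inj₂ x) (inj₁ a) = EndAdj a x
SubAdj G t (inj₂ x) (inj₂ y) =
  eu x ≡ eu y × ev x ≡ ev y × (suc (toℕ (pos x)) ≡ toℕ (pos y) ⊎ suc (toℕ (pos y)) ≡ toℕ (pos x))

Subdiv : ∀ {n} → SimpleGraph n → ℕ → Graph
Subdiv G t = record { V = Fin _ ⊎ Inner G t ; Adj = SubAdj G t }

FracPow : ∀ {n} → SimpleGraph n → ℕ → ℕ → Graph
FracPow G r s = Power (Subdiv G (suc (2 * s))) (suc (2 * r))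

-- (r,s) belongs to the set whose supremum is θ(G):
-- χ(G^{(2r+1)/(2s+1)}) ≤ χ(G) and (2r+1)/(2s+1) < og(G)
ThetaSet : ∀ {n} → SimpleGraph n → ℕ → ℕ → Set
ThetaSet G r s = ChiLe (FracPow G r s) (toGraph G)
  × ∃[ g ] (OddGirthIs (toGraph G) g × suc (2 * r) < g * suc (2 * s))

-- θ(G) = p/q  (q > 0): p/q is the supremum (least upper bound) of the set
ThetaIs : ∀ {n} → SimpleGraph n → ℕ → ℕ → Set
ThetaIs G p q =
  (∀ r s → ThetaSet G r s → suc (2 * r) * q ≤ p * suc (2 * s))
  × (∀ a b → 1 ≤ b → (∀ r s → ThetaSet G r s → suc (2 * r) * b ≤ a * suc (2 * s)) → p * b ≤ a * q)

{-# OPTIONS --safe #-}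

-- Both quantities are governed by G → K_{(6r+3)/(3r+1-s)}.  Put points on a circle and
-- regard "adjacent" as "antipodal up to a small error"; errors add up along walks.
--
-- If G → K_{N/D} with N < 3D, interpolate along the subdivided edges so that each of the
-- 2s+1 steps carries an equal share of the error.  Walks of length 2r+1 = 2s+3 then still
-- end within a sixth of the circumference of the antipode once s is large, so that cutting
-- the circle into three arcs is a proper 3-colouring of G^{(2r+1)/(2s+1)}.
--
-- Conversely, let c be a 3-colouring of H^{2r+1}, where H = S_{2s+1}(G).  It defines a
-- homomorphism from H to the cycle of length 3(2r+1): the colour c(x) selects an arc of
-- 2r+1 points, and the place in that arc is read off from the first k ≤ r such that walks
-- of length k from x reach two colours, and from the colour of the neighbours of x.
-- Composing 2s+1 steps gives G → K_{(6r+3)/(3r+1-s)}, a ratio below 3 when s < r.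
--
-- Every case distinction on an undecidable property of walks is made inside a double
-- negation, since the final goals are decidable.
module Submission where

open import Defs hiding (sym)
open import Data.Bool using (Bool; true; false)
open import Data.Empty using (⊥; ⊥-elim)
open import Data.Fin using (Fin; zero; suc; toℕ; fromℕ<)
open import Data.Fin.Properties using (all?; any?; toℕ-injective; toℕ<n; toℕ-fromℕ<; toℕ≤pred[n]; fromℕ<-injective) renaming (_≟_ to _≟ᶠ_)
open import Data.Integer as ℤ using (ℤ; +_; ∣_∣)
import Data.Integer.DivMod as ℤ
import Data.Integer.Properties as ℤ
open import Data.Integer.Tactic.RingSolver using (solve-∀)
open import Data.Nat
open import Data.Nat.DivMod using (m<n*o⇒m/o<n; m≡m%n+[m/n]*n; m%n<n)
open import Data.Nat.Induction using (<-rec)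
open import Data.Nat.Properties
open import Data.Nat.Tactic.RingSolver using () renaming (solve-∀ to solveℕ-∀)
open import Data.Product using (Σ; _×_; ∃; ∃-syntax; _,_; proj₁; proj₂)
open import Data.Sum using (_⊎_; inj₁; inj₂; [_,_]′)
open import Data.Unit using (⊤; tt)
open import Function using (_∘_; case_of_)
open import Relation.Binary.Definitions using (tri<; tri≈; tri>)
open import Relation.Binary.PropositionalEquality using (_≡_; _≢_; refl; sym; trans; cong; cong₂; subst; subst₂; module ≡-Reasoning)
open import Relation.Nullary using (¬_; Dec; yes; no; contradiction)
open import Relation.Nullary.Decidable using (_×-dec_; _⊎-dec_; ¬¬-excluded-middle; decidable-stable; from-yes)

-- Double-negated choice, least numbers, parity

-- Finiteness lets double negation pass through the quantifier, so data known only up to double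
-- negation can be chosen at all vertices of `G` at once.
¬¬-finite-choice : ∀ {n} {P : Fin n → Set} → (∀ i → ¬ ¬ P i) → ¬ ¬ (∀ i → P i)
¬¬-finite-choice {zero}  h no-all = no-all λ ()
¬¬-finite-choice {suc n} h no-all =
  h zero λ p₀ → ¬¬-finite-choice (h ∘ suc) λ ps →
  no-all λ { zero → p₀ ; (suc i) → ps i }

Least : (ℕ → Set) → ℕ → Set
Least P k = P k × (∀ j → j < k → ¬ P j)

¬¬-least : ∀ {P : ℕ → Set} {n} → P n → ¬ ¬ ∃ (Least P)
¬¬-least {P} {n} pn no-least =
  <-rec (λ k → ¬ P k) (λ k ih pk → no-least (k , pk , λ j j<k → ih j<k)) n pn

even⊎odd : ∀ k → (∃[ i ] k ≡ i + i) ⊎ (∃[ i ] k ≡ suc (i + i))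
even⊎odd zero = inj₁ (0 , refl)
even⊎odd (suc k) with even⊎odd k
... | inj₁ (i , refl) = inj₂ (i , refl)
... | inj₂ (i , refl) = inj₁ (suc i , cong suc (sym (+-suc i i)))

2*-as-sum : ∀ i → 2 * i ≡ i + i
2*-as-sum i = cong (λ z → i + z) (+-identityʳ i)

double≢suc-double : ∀ i j → i + i ≢ suc (j + j)
double≢suc-double i j eq =
  even≢odd i j (trans (2*-as-sum i) (trans eq (cong suc (sym (2*-as-sum j)))))

double-injective : ∀ i j → i + i ≡ j + j → i ≡ j
double-injective i j eq = *-cancelˡ-≡ i j 2 (trans (2*-as-sum i) (trans eq (sym (2*-as-sum j))))

odd-double : ∀ i → Odd (suc (i + i))
odd-double i = i , cong suc (sym (2*-as-sum i))

-- Walks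

Symmetric : Graph → Set
Symmetric G = ∀ {x y} → Adj G x y → Adj G y x

module _ {G : Graph} where

  infixr 5 _++ʷ_
  _++ʷ_ : ∀ {i j x y z} → Walk G i x y → Walk G j y z → Walk G (i + j) x z
  nil      ++ʷ v = v
  cons e w ++ʷ v = cons e (w ++ʷ v)

  castʷ : ∀ {i j x y} → i ≡ j → Walk G i x y → Walk G j x y
  castʷ {x = x} {y} = subst (λ k → Walk G k x y)

  reverseʷ : Symmetric G → ∀ {k x y} → Walk G k x y → Walk G k y x
  reverseʷ sym-G nil = nil
  reverseʷ sym-G {suc k} (cons e w) =
    castʷ (+-comm k 1) (reverseʷ sym-G w ++ʷ cons (sym-G e) nil)

  -- Each round trip along the first edge adds two steps; the length `suc j` ensures that there is a
  -- first edge.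
  padʷ : Symmetric G → ∀ i {j x y} → Walk G (suc j) x y → Walk G (i + i + suc j) x y
  padʷ sym-G zero    w = w
  padʷ sym-G (suc i) {j} w = castʷ (lengths i j) (detour (padʷ sym-G i w) (m≤n+m (suc j) (i + i)))
    where
    lengths : ∀ i j → suc (suc (i + i + suc j)) ≡ suc i + suc i + suc j
    lengths = solveℕ-∀
    detour : ∀ {k l x y} → Walk G k x y → suc l ≤ k → Walk G (suc (suc k)) x y
    detour (cons e w) _ = cons e (cons (sym-G e) (cons e w))

  vertexAt : ∀ {k x y} → Walk G k x y → ℕ → V G
  vertexAt {x = x} w          zero    = x
  vertexAt {x = x} nil        (suc i) = x
  vertexAt         (cons e w) (suc i) = vertexAt w i

  vertexAt-end : ∀ {k x y} (w : Walk G k x y) → vertexAt w k ≡ y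
  vertexAt-end nil        = refl
  vertexAt-end (cons e w) = vertexAt-end w

  vertexAt-adj : ∀ {k x y} (w : Walk G k x y) i → i < k → Adj G (vertexAt w i) (vertexAt w (suc i))
  vertexAt-adj (cons e nil)         zero    _       = e
  vertexAt-adj (cons e (cons e′ w)) zero    _       = e
  vertexAt-adj (cons e w)           (suc i) (s≤s l) = vertexAt-adj w i l

  segment : ∀ {k x y} (w : Walk G k x y) i d → i + d ≤ k →
            Walk G d (vertexAt w i) (vertexAt w (i + d))
  segment w i zero    l = subst (λ j → Walk G 0 (vertexAt w i) (vertexAt w j)) (sym (+-identityʳ i)) nil
  segment {k} w i (suc d) l =
    cons (vertexAt-adj w i (≤-trans (s≤s (m≤m+n i d)) l′))
         (subst (λ j → Walk G d (vertexAt w (suc i)) (vertexAt w j)) (sym (+-suc i d)) (segment w (suc i) d l′))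
    where l′ = subst (_≤ k) (+-suc i d) l

-- Odd girth

module _ {n : ℕ} (G : SimpleGraph n) where

  adj-sym : Symmetric (toGraph G)
  adj-sym {x} {y} e = trans (SimpleGraph.sym G y x) e

  -- A shortest odd closed walk is a cycle: a repeated vertex splits it into two
  -- shorter closed walks, one of which is odd.
  no-odd-closed-walk : (∀ ℓ → Odd ℓ → ¬ HasCycle (toGraph G) ℓ) →
                       ∀ ℓ → Odd ℓ → ∀ x → ¬ Walk (toGraph G) ℓ x x
  no-odd-closed-walk acyclic = <-rec _ step
    where
    step : ∀ ℓ → (∀ {k} → k < ℓ → Odd k → ∀ x → ¬ Walk (toGraph G) k x x) →
           Odd ℓ → ∀ x → ¬ Walk (toGraph G) ℓ x x
    step ℓ ih odd-ℓ x w with any? (λ (i : Fin ℓ) → any? λ (j : Fin ℓ) →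
                        (toℕ i <? toℕ j) ×-dec (vertexAt w (toℕ i) ≟ᶠ vertexAt w (toℕ j)))
    ... | yes (i , j , i<j , same) = split (m+[n∸m]≡n (<⇒≤ i<j)) (m<n⇒0<n∸m i<j)
      where
      split : ∀ {d} → toℕ i + d ≡ toℕ j → 0 < d → ⊥
      split {d} i+d≡j 0<d = case even⊎odd d of λ where
          (inj₂ (h , refl)) → ih (≤-<-trans (m≤n+m _ (toℕ i)) (subst (_< ℓ) (sym i+d≡j) (toℕ<n j))) (odd-double h) _ loop
          (inj₁ (h , d≡)) → case even⊎odd (toℕ i + rest) of λ where
            (inj₂ (h′ , p)) → ih (subst (toℕ i + rest <_) total (m<n+m _ 0<d)) (subst Odd (sym p) (odd-double h′)) _ outer
            (inj₁ (h′ , p)) → double≢suc-double (h + h′) (proj₁ odd-ℓ)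
              (trans (trans (swap h h′) (cong₂ _+_ (sym d≡) (sym p))) (trans total (trans (proj₂ odd-ℓ) (cong suc (2*-as-sum (proj₁ odd-ℓ))))))
        where
        rest : ℕ
        rest = ℓ ∸ toℕ j
        j+rest : toℕ j + rest ≡ ℓ
        j+rest = m+[n∸m]≡n (<⇒≤ (toℕ<n j))
        total : d + (toℕ i + rest) ≡ ℓ
        total = trans (shuffle d (toℕ i) rest) (trans (cong (_+ rest) i+d≡j) j+rest)
          where
          shuffle : ∀ d i r → d + (i + r) ≡ i + d + r
          shuffle = solveℕ-∀
        swap : ∀ h k → h + k + (h + k) ≡ h + h + (k + k)
        swap = solveℕ-∀
        loop : Walk (toGraph G) d (vertexAt w (toℕ i)) (vertexAt w (toℕ i))
        loop = subst (Walk _ d _) (trans (cong (vertexAt w) i+d≡j) (sym same))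
                 (segment w (toℕ i) d (subst (_≤ ℓ) (sym i+d≡j) (<⇒≤ (toℕ<n j))))
        outer : Walk (toGraph G) (toℕ i + rest) x x
        outer = subst (λ v → Walk _ (toℕ i) x v) same (segment w 0 (toℕ i) (<⇒≤ (toℕ<n i)))
             ++ʷ subst (Walk _ rest _) (trans (cong (vertexAt w) j+rest) (vertexAt-end w))
                   (segment w (toℕ j) rest (≤-reflexive j+rest))
    ... | no distinct = acyclic ℓ odd-ℓ (3≤ℓ odd-ℓ w , (λ i → vertexAt w (toℕ i)) , injective , adjacent)
      where
      -- Length 1 would be a loop at `x`, excluded by `irrefl`.
      3≤ℓ : ∀ {ℓ} → Odd ℓ → Walk (toGraph G) ℓ x x → 3 ≤ ℓ
      3≤ℓ (zero  , refl) (cons e nil) = contradiction (trans (sym (irrefl G x)) e) λ ()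
      3≤ℓ (suc h , refl) _ = s≤s (s≤s (subst (1 ≤_) (sym (+-suc h _)) (s≤s z≤n)))
      injective : ∀ {i j} → vertexAt w (toℕ i) ≡ vertexAt w (toℕ j) → i ≡ j
      injective {i} {j} eq with <-cmp (toℕ i) (toℕ j)
      ... | tri< i<j _ _ = contradiction (i , j , i<j , eq) distinct
      ... | tri≈ _ i≡j _ = toℕ-injective i≡j
      ... | tri> _ _ j<i = contradiction (j , i , j<i , sym eq) distinct
      adjacent : ∀ i j → suc (toℕ i) ≡ toℕ j ⊎ (suc (toℕ i) ≡ ℓ × toℕ j ≡ 0) →
                 Adj (toGraph G) (vertexAt w (toℕ i)) (vertexAt w (toℕ j))
      adjacent i j (inj₁ eq) = subst (λ k → Adj (toGraph G) _ (vertexAt w k)) eq (vertexAt-adj w (toℕ i) (toℕ<n i))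
      adjacent i j (inj₂ (last , first)) =
        subst (Adj (toGraph G) _)
          (trans (trans (cong (vertexAt w) last) (vertexAt-end w)) (sym (cong (vertexAt w) first)))
          (vertexAt-adj w (toℕ i) (toℕ<n i))

  -- Colour each vertex by the parity of a walk from the least vertex of its component.
  ¬¬-bipartite : (∀ ℓ → Odd ℓ → ∀ x → ¬ Walk (toGraph G) ℓ x x) → ¬ ¬ Colourable (toGraph G) 2
  ¬¬-bipartite no-odd not-2 =
    ¬¬-finite-choice ¬¬-root λ root →
    ¬¬-finite-choice {P = λ v → Dec (Even (proj₁ (root v)) v)} (λ v → ¬¬-excluded-middle) λ even? →
    not-2 ((λ v → colour (even? v)) , λ x y e →
      proper e (proj₁ (proj₂ (root x))) (even? x) (even? y) (same-root root x y e))
    where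
    Reach Even : Fin n → Fin n → Set
    Reach u v = ∃[ k ] Walk (toGraph G) k u v
    Even u v = ∃[ h ] Walk (toGraph G) (h + h) u v
    Root : Fin n → Set
    Root v = Σ (Fin n) λ u → Reach u v × (∀ u′ → Reach u′ v → toℕ u ≤ toℕ u′)
    ¬¬-root : ∀ v → ¬ ¬ Root v
    ¬¬-root v no-root =
      ¬¬-least {P = λ k → Σ (Fin n) λ u → toℕ u ≡ k × Reach u v} (v , refl , 0 , nil)
      λ { (_ , (u , refl , reach) , least) →
          no-root (u , reach , λ u′ reach′ → ≮⇒≥ λ lt → least (toℕ u′) lt (u′ , refl , reach′)) }
    extend : ∀ {u x y} → Adj (toGraph G) x y → Reach u x → Reach u y
    extend e (k , w) = k + 1 , w ++ʷ cons e nil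
    same-root : (root : ∀ v → Root v) → ∀ x y → Adj (toGraph G) x y → proj₁ (root x) ≡ proj₁ (root y)
    same-root root x y e with root x | root y
    ... | u , reach , least | u′ , reach′ , least′ =
      toℕ-injective (≤-antisym (least u′ (extend (adj-sym e) reach′)) (least′ u (extend e reach)))
    colour : ∀ {A : Set} → Dec A → Fin 2
    colour (yes _) = zero
    colour (no _)  = suc zero
    odd-walk : ∀ {u v} → Reach u v → ¬ Even u v → ∃[ h ] Walk (toGraph G) (suc (h + h)) u v
    odd-walk (k , w) not-even with even⊎odd k
    ... | inj₁ (h , refl) = contradiction (h , w) not-even
    ... | inj₂ (h , refl) = h , w
    proper : ∀ {x y u u′} → Adj (toGraph G) x y → Reach u x → (a : Dec (Even u x)) (b : Dec (Even u′ y)) →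
             u ≡ u′ → colour a ≢ colour b
    -- Two even walks from the common root and the edge close up to an odd closed walk.
    proper {u = u} e _ (yes (h , w)) (yes (h′ , w′)) refl _ =
      no-odd _ (subst Odd (lengths h h′) (odd-double (h + h′))) u (w ++ʷ cons e (reverseʷ adj-sym w′))
      where
      lengths : ∀ h k → suc (h + k + (h + k)) ≡ h + h + suc (k + k)
      lengths = solveℕ-∀
    -- An odd walk to `x` followed by the edge is an even walk to `y`.
    proper e reach (no odd-x) (no odd-y) refl _ with odd-walk reach odd-x
    ... | h , w = odd-y (suc h , castʷ (lengths h) (w ++ʷ cons e nil))
      where
      lengths : ∀ h → suc (h + h) + 1 ≡ suc h + suc h
      lengths = solveℕ-∀
    proper e _ (yes _) (no _) _ ()
    proper e _ (no _) (yes _) _ ()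

  -- Membership in `ThetaSet` includes the existence of an odd girth. Without one there is no odd
  -- cycle, hence no odd closed walk, and the graph would be bipartite.
  ¬¬-oddGirth : ¬ Colourable (toGraph G) 2 → ¬ ¬ ∃ (OddGirthIs (toGraph G))
  ¬¬-oddGirth not-2 no-girth = ¬¬-bipartite (no-odd-closed-walk acyclic) not-2
    where
    acyclic : ∀ ℓ → Odd ℓ → ¬ HasCycle (toGraph G) ℓ
    acyclic ℓ odd cycle =
      ¬¬-least {P = λ k → Odd k × HasCycle (toGraph G) k} (odd , cycle)
      λ { (g , (odd-g , cycle-g) , least) →
          no-girth (g , odd-g , cycle-g , λ k odd-k cycle-k → ≮⇒≥ λ k<g → least k k<g (odd-k , cycle-k)) }

-- Near-antipodal jumps on a circle

-- On a circle of circumference 2 * M, walking j steps, each an antipodal jump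
-- up to an error of at most w, leads from a to b.
record Near (M w j : ℕ) (a b : ℤ) : Set where
  constructor near
  field
    turns error  : ℤ
    displacement : b ℤ.- a ≡ + M ℤ.* (+ 2 ℤ.* turns ℤ.+ + j) ℤ.+ error
    error≤       : ∣ error ∣ ≤ j * w

Near-sym : ∀ {M w j a b} → Near M w j a b → Near M w j b a
Near-sym {M} {w} {j} {a} {b} (near o e eq e≤) =
  near (ℤ.- o ℤ.- + j) (ℤ.- e)
    (trans (flip a b) (trans (cong ℤ.-_ eq) (distribute (+ M) o (+ j) e)))
    (subst (_≤ j * w) (sym (ℤ.∣-i∣≡∣i∣ e)) e≤)
  where
  flip : ∀ a b → a ℤ.- b ≡ ℤ.- (b ℤ.- a)
  flip = solve-∀
  distribute : ∀ M o j e → ℤ.- (M ℤ.* (+ 2 ℤ.* o ℤ.+ j) ℤ.+ e) ≡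
               M ℤ.* (+ 2 ℤ.* (ℤ.- o ℤ.- j) ℤ.+ j) ℤ.+ ℤ.- e
  distribute = solve-∀

Near-trans : ∀ {M w j a b c} → Near M w 1 a b → Near M w j b c → Near M w (suc j) a c
Near-trans {M} {w} {j} {a} {b} {c} (near o e eq e≤) (near o′ e′ eq′ e′≤) =
  near (o ℤ.+ o′) (e ℤ.+ e′)
    (trans (telescope a b c) (trans (cong₂ ℤ._+_ eq eq′) (collect (+ M) o o′ (+ j) e e′)))
    (≤-trans (ℤ.∣i+j∣≤∣i∣+∣j∣ e e′) (+-mono-≤ (subst (∣ e ∣ ≤_) (*-identityˡ w) e≤) e′≤))
  where
  telescope : ∀ a b c → c ℤ.- a ≡ (b ℤ.- a) ℤ.+ (c ℤ.- b)
  telescope = solve-∀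
  collect : ∀ M o o′ j e e′ →
    (M ℤ.* (+ 2 ℤ.* o ℤ.+ + 1) ℤ.+ e) ℤ.+ (M ℤ.* (+ 2 ℤ.* o′ ℤ.+ j) ℤ.+ e′) ≡
    M ℤ.* (+ 2 ℤ.* (o ℤ.+ o′) ℤ.+ (+ 1 ℤ.+ j)) ℤ.+ (e ℤ.+ e′)
  collect = solve-∀

1≤∣odd∣ : ∀ o → 1 ≤ ∣ + 2 ℤ.* o ℤ.+ + 1 ∣
1≤∣odd∣ (+ k)      = subst (λ z → 1 ≤ ∣ z ℤ.+ + 1 ∣) (ℤ.pos-* 2 k) (m≤n+m 1 (2 * k))
1≤∣odd∣ ℤ.-[1+ k ] =
  subst (1 ≤_) (trans (sym (ℤ.∣-i∣≡∣i∣ (+ 2 ℤ.* + k ℤ.+ + 1))) (cong ∣_∣ (reflect (+ k)))) (1≤∣odd∣ (+ k))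
  where
  reflect : ∀ k → ℤ.- (+ 2 ℤ.* k ℤ.+ + 1) ≡ + 2 ℤ.* ℤ.- (+ 1 ℤ.+ k) ℤ.+ + 1
  reflect = solve-∀

-- An odd number of jumps ends far away, whatever the lifts of the endpoints to the line.
Near-far : ∀ {M w h a b} z → Near M w (suc (2 * h)) a b →
           M ≤ ∣ b ℤ.- a ℤ.+ + (2 * M) ℤ.* z ∣ + suc (2 * h) * w
Near-far {M} {w} {h} {a} {b} z (near o e eq e≤) = begin
  M                                                  ≡⟨ *-identityʳ M ⟨
  M * 1                                              ≤⟨ *-monoʳ-≤ M (1≤∣odd∣ p) ⟩
  M * ∣ + 2 ℤ.* p ℤ.+ + 1 ∣                          ≡⟨ ℤ.∣i*j∣≡∣i∣*∣j∣ (+ M) (+ 2 ℤ.* p ℤ.+ + 1) ⟨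
  ∣ + M ℤ.* (+ 2 ℤ.* p ℤ.+ + 1) ∣                    ≡⟨ cong ∣_∣ regroup ⟩
  ∣ (b ℤ.- a ℤ.+ + (2 * M) ℤ.* z) ℤ.- e ∣            ≤⟨ ℤ.∣i-j∣≤∣i∣+∣j∣ (b ℤ.- a ℤ.+ + (2 * M) ℤ.* z) e ⟩
  ∣ b ℤ.- a ℤ.+ + (2 * M) ℤ.* z ∣ + ∣ e ∣            ≤⟨ +-monoʳ-≤ _ e≤ ⟩
  ∣ b ℤ.- a ℤ.+ + (2 * M) ℤ.* z ∣ + suc (2 * h) * w  ∎
  where
  open ≤-Reasoning
  -- Up to the error `e`, the lifted displacement is the odd multiple `2p + 1` of `M`, which cannot
  -- vanish.
  p = o ℤ.+ + h ℤ.+ z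
  expand : ∀ M o h z e → M ℤ.* (+ 2 ℤ.* (o ℤ.+ h ℤ.+ z) ℤ.+ + 1) ≡
           (M ℤ.* (+ 2 ℤ.* o ℤ.+ (+ 1 ℤ.+ + 2 ℤ.* h)) ℤ.+ e ℤ.+ (+ 2 ℤ.* M) ℤ.* z) ℤ.- e
  expand = solve-∀
  regroup : + M ℤ.* (+ 2 ℤ.* p ℤ.+ + 1) ≡ (b ℤ.- a ℤ.+ + (2 * M) ℤ.* z) ℤ.- e
  regroup = trans (expand (+ M) o (+ h) z e)
    (cong₂ (λ u v → u ℤ.+ v ℤ.* z ℤ.- e)
      (trans (cong (λ k → + M ℤ.* (+ 2 ℤ.* o ℤ.+ (+ 1 ℤ.+ k)) ℤ.+ e) (sym (ℤ.pos-* 2 h))) (sym eq))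
      (sym (ℤ.pos-* 2 M)))

module _ {H : Graph} (Pos : V H → Set) (value : ∀ {x} → Pos x → ℤ) {M w : ℕ}
         (¬¬-pos : ∀ x → ¬ ¬ Pos x)
         (near-edge : ∀ {x y} → Adj H x y → (p : Pos x) (q : Pos y) → Near M w 1 (value p) (value q))
  where

  -- Serves both directions: positions read off from a colouring exist only up to double negation,
  -- while for interpolated positions `Pos` is trivial.
  near-walk : ∀ {j x y} → Walk H (suc j) x y → (p : Pos x) (q : Pos y) →
              ¬ ¬ Near M w (suc j) (value p) (value q)
  near-walk (cons e nil) p q not-near = not-near (near-edge e p q)
  near-walk (cons e v@(cons _ _)) p q not-near =
    ¬¬-pos _ λ m → near-walk v m q λ rest → not-near (Near-trans (near-edge e p m) rest)

-- From 3-colourings of odd powers to positions on a circle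

next : Fin 3 → Fin 3
next zero             = suc zero
next (suc zero)       = suc (suc zero)
next (suc (suc zero)) = zero

next-asym : ∀ α → α ≢ next (next α)
next-asym zero ()
next-asym (suc zero) ()
next-asym (suc (suc zero)) ()

next-connex : ∀ α β → α ≡ β ⊎ β ≡ next α ⊎ α ≡ next β
next-connex = from-yes (all? λ α → all? λ β → (α ≟ᶠ β) ⊎-dec ((β ≟ᶠ next α) ⊎-dec (α ≟ᶠ next β)))

-- Pigeonhole: two pairs of distinct colours out of three share a colour. Checked by exhaustion.
three-colours : ∀ (α α′ β β′ : Fin 3) → α ≡ α′ ⊎ β ≡ β′ ⊎ (α ≡ β ⊎ α ≡ β′) ⊎ (α′ ≡ β ⊎ α′ ≡ β′)
three-colours = from-yes (all? λ (α : Fin 3) → all? λ (α′ : Fin 3) → all? λ (β : Fin 3) → all? λ (β′ : Fin 3) →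
  (α ≟ᶠ α′) ⊎-dec ((β ≟ᶠ β′) ⊎-dec (((α ≟ᶠ β) ⊎-dec (α ≟ᶠ β′)) ⊎-dec ((α′ ≟ᶠ β) ⊎-dec (α′ ≟ᶠ β′)))))

-- The integer `o` records the wrap-around from colour 2 to colour 0; it becomes the number of full
-- turns in `near-ascending`.
next-as-shift : ∀ α → ∃[ o ] + toℕ (next α) ≡ + toℕ α ℤ.+ + 3 ℤ.* o ℤ.+ + 1
next-as-shift zero             = + 0 , refl
next-as-shift (suc zero)       = + 0 , refl
next-as-shift (suc (suc zero)) = ℤ.-[1+ 0 ] , refl

-- The distance q from the centre of an arc of 2r+1 points to a point from which two arcs
-- are first reached after k near-antipodal jumps: k - 1 = 2q if k is odd (the jumps end
-- opposite the arc), and k = 2(r + 1 - q) if k is even (they end around the arc itself).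
-- Parity separates the two alternatives.
HasOffset : ℕ → ℕ → ℕ → Set
HasOffset r k q = k ≡ suc (q + q) ⊎ k + (q + q) ≡ suc r + suc r

offset-exists : ∀ {r k} → k ≤ suc r → ∃ (HasOffset r k)
offset-exists {r} {k} k≤ with even⊎odd k
... | inj₂ (i , eq) = i , inj₁ eq
... | inj₁ (i , refl) with m≤n⇒∃[o]m+o≡n (≤-trans (m≤m+n i i) k≤)
... | q , eq = q , inj₂ (trans (swap i q) (cong₂ _+_ eq eq))
  where
  swap : ∀ i q → i + i + (q + q) ≡ (i + q) + (i + q)
  swap = solveℕ-∀

offset≤ : ∀ {r k q} → 1 ≤ k → k ≤ suc r → HasOffset r k q → q ≤ r
offset≤ {q = q} 1≤k k≤ (inj₁ refl) = ≤-trans (m≤m+n q q) (≤-pred k≤)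
offset≤ {r} {k} {q} 1≤k k≤ (inj₂ eq) = ≤-pred (≰⇒> λ r<q →
  <⇒≱ (<-≤-trans (m<n+m (q + q) 1≤k) (≤-reflexive eq)) (+-mono-≤ r<q r<q))

offset-one : ∀ {r q} → HasOffset r 1 q → q ≡ 0
offset-one {q = zero}  _         = refl
offset-one {q = suc q} (inj₁ ())
offset-one {r} {suc q} (inj₂ eq) = contradiction (sym eq) (double≢suc-double (suc r) (suc q))

-- One of `k` and `suc k` is odd and the other even, so the two different alternatives of
-- `HasOffset` apply. Eliminating `k` leaves `r` if `k` is odd and `suc r` if `k` is even.
offset-sum-suc : ∀ {r k q q′} → HasOffset r k q → HasOffset r (suc k) q′ → q + q′ ≡ r ⊎ q + q′ ≡ suc r
offset-sum-suc {q = q} {q′} (inj₁ refl) (inj₁ eq) = contradiction (sym (suc-injective eq)) (double≢suc-double q′ q)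
offset-sum-suc {r} {q = q} {q′} (inj₁ refl) (inj₂ eq) =
  inj₁ (double-injective _ _ (suc-injective (suc-injective (trans (swap q q′) (trans eq (cong suc (+-suc r r)))))))
  where
  swap : ∀ q q′ → suc (suc (q + q′ + (q + q′))) ≡ suc (suc (q + q)) + (q′ + q′)
  swap = solveℕ-∀
offset-sum-suc {r} {q = q} {q′} (inj₂ eq) (inj₁ refl) = inj₂ (double-injective _ _ (trans (swap q q′) eq))
  where
  swap : ∀ q q′ → q + q′ + (q + q′) ≡ q′ + q′ + (q + q)
  swap = solveℕ-∀
offset-sum-suc {r} {k} {q = q} {q′} (inj₂ eq) (inj₂ eq′) =
  contradiction (+-cancelˡ-≡ k _ _ (trans eq (trans (sym eq′) (sym (+-suc k _))))) (double≢suc-double q q′)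

offset-sum-top : ∀ {r q q′} → HasOffset r (suc r) q → HasOffset r (suc r) q′ → q + q′ ≡ r ⊎ q + q′ ≡ suc r
offset-sum-top {r} {q} {q′} (inj₁ eq) (inj₁ eq′) =
  inj₁ (trans (cong (_+ q′) (double-injective q q′ (suc-injective (trans (sym eq) eq′)))) (suc-injective (sym eq′)))
offset-sum-top {r} {q} {q′} (inj₁ eq) (inj₂ eq′) =
  contradiction (trans (+-cancelˡ-≡ (suc r) _ _ eq′) eq) (double≢suc-double q′ q)
offset-sum-top {r} {q} {q′} (inj₂ eq) (inj₁ eq′) =
  contradiction (trans (+-cancelˡ-≡ (suc r) _ _ eq) eq′) (double≢suc-double q q′)
offset-sum-top {r} {q} {q′} (inj₂ eq) (inj₂ eq′) =
  inj₂ (trans (cong (_+ q′) (double-injective q q′ (+-cancelˡ-≡ (suc r) _ _ (trans eq (sym eq′))))) (+-cancelˡ-≡ (suc r) _ _ eq′))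

-- Let `m = 2r + 1`. Here `v` lies `q` before the centre of one arc and `v′` lies `q′` after the
-- centre of the next, so modulo full turns they are `m + q + q′` apart. Doubled, this is `3m - 1`
-- or `3m + 1`. Doubling makes antipodes integral, since `3m` is odd.
near-ascending : ∀ r α {q q′ v v′} → v + q ≡ toℕ α * suc (2 * r) + r →
  v′ ≡ toℕ (next α) * suc (2 * r) + (r + q′) → q + q′ ≡ r ⊎ q + q′ ≡ suc r →
  Near (3 * suc (2 * r)) 1 1 (+ (2 * v)) (+ (2 * v′))
near-ascending r α {q} {q′} {v} {v′} vq v′q total with next-as-shift α
... | o , β≡ = [ (λ eq → build 0 (trans eq (sym (+-identityʳ r))) ≤-refl)
               , (λ eq → build 1 (trans eq (+-comm 1 r)) ≤-refl) ]′ total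
  where
  open ≡-Reasoning
  m = suc (2 * r)
  α-ℤ β-ℤ M : ℤ
  α-ℤ = + toℕ α
  β-ℤ = + toℕ (next α)
  M = + 1 ℤ.+ + 2 ℤ.* + r
  M≡ : + m ≡ M
  M≡ = cong (λ z → + 1 ℤ.+ z) (ℤ.pos-* 2 r)
  pos-*m : ∀ k → + (k * m) ≡ + k ℤ.* M
  pos-*m k = trans (ℤ.pos-* k m) (cong (+ k ℤ.*_) M≡)
  isolate : ∀ v v′ q → + 2 ℤ.* v′ ℤ.- + 2 ℤ.* v ≡ + 2 ℤ.* v′ ℤ.- + 2 ℤ.* (v ℤ.+ q) ℤ.+ + 2 ℤ.* q
  isolate = solve-∀
  collect : ∀ a b r q q′ → + 2 ℤ.* (b ℤ.* (+ 1 ℤ.+ + 2 ℤ.* r) ℤ.+ (r ℤ.+ q′)) ℤ.- + 2 ℤ.* (a ℤ.* (+ 1 ℤ.+ + 2 ℤ.* r) ℤ.+ r) ℤ.+ + 2 ℤ.* q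
            ≡ + 2 ℤ.* (b ℤ.- a) ℤ.* (+ 1 ℤ.+ + 2 ℤ.* r) ℤ.+ + 2 ℤ.* (q ℤ.+ q′)
  collect = solve-∀
  finish : ∀ a o r k → + 2 ℤ.* ((a ℤ.+ + 3 ℤ.* o ℤ.+ + 1) ℤ.- a) ℤ.* (+ 1 ℤ.+ + 2 ℤ.* r) ℤ.+ + 2 ℤ.* (r ℤ.+ k)
           ≡ + 3 ℤ.* (+ 1 ℤ.+ + 2 ℤ.* r) ℤ.* (+ 2 ℤ.* o ℤ.+ + 1) ℤ.+ (+ 2 ℤ.* k ℤ.- + 1)
  finish = solve-∀
  build : ∀ k → q + q′ ≡ r + k → ∣ + 2 ℤ.* + k ℤ.- + 1 ∣ ≤ 1 → Near (3 * m) 1 1 (+ (2 * v)) (+ (2 * v′))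
  build k sum small = near o (+ 2 ℤ.* + k ℤ.- + 1) (begin
    + (2 * v′) ℤ.- + (2 * v)
      ≡⟨ cong₂ ℤ._-_ (ℤ.pos-* 2 v′) (ℤ.pos-* 2 v) ⟩
    + 2 ℤ.* + v′ ℤ.- + 2 ℤ.* + v
      ≡⟨ isolate (+ v) (+ v′) (+ q) ⟩
    + 2 ℤ.* + v′ ℤ.- + 2 ℤ.* + (v + q) ℤ.+ + 2 ℤ.* + q
      ≡⟨ cong₂ (λ a b → + 2 ℤ.* a ℤ.- + 2 ℤ.* b ℤ.+ + 2 ℤ.* + q)
           (trans (cong +_ v′q) (cong (ℤ._+ + (r + q′)) (pos-*m (toℕ (next α)))))
           (trans (cong +_ vq) (cong (ℤ._+ + r) (pos-*m (toℕ α)))) ⟩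
    + 2 ℤ.* (β-ℤ ℤ.* M ℤ.+ + (r + q′)) ℤ.- + 2 ℤ.* (α-ℤ ℤ.* M ℤ.+ + r) ℤ.+ + 2 ℤ.* + q
      ≡⟨ collect α-ℤ β-ℤ (+ r) (+ q) (+ q′) ⟩
    + 2 ℤ.* (β-ℤ ℤ.- α-ℤ) ℤ.* M ℤ.+ + 2 ℤ.* + (q + q′)
      ≡⟨ cong₂ (λ b s → + 2 ℤ.* (b ℤ.- α-ℤ) ℤ.* M ℤ.+ + 2 ℤ.* s) β≡ (cong +_ sum) ⟩
    + 2 ℤ.* ((α-ℤ ℤ.+ + 3 ℤ.* o ℤ.+ + 1) ℤ.- α-ℤ) ℤ.* M ℤ.+ + 2 ℤ.* + (r + k)
      ≡⟨ finish α-ℤ o (+ r) (+ k) ⟩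
    + 3 ℤ.* M ℤ.* (+ 2 ℤ.* o ℤ.+ + 1) ℤ.+ (+ 2 ℤ.* + k ℤ.- + 1)
      ≡⟨ cong (λ z → z ℤ.* (+ 2 ℤ.* o ℤ.+ + 1) ℤ.+ (+ 2 ℤ.* + k ℤ.- + 1)) (sym (pos-*m 3)) ⟩
    + (3 * m) ℤ.* (+ 2 ℤ.* o ℤ.+ + 1) ℤ.+ (+ 2 ℤ.* + k ℤ.- + 1) ∎) small

module _ {H : Graph} (sym-H : Symmetric H) (r : ℕ) (c : V H → Fin 3)
         (proper : ∀ x y → Walk H (suc (2 * r)) x y → c x ≢ c y) where

  Mixed : ℕ → V H → Set
  Mixed k x = ∃[ y ] ∃[ z ] (Walk H k x y × Walk H k x z × c y ≢ c z)

  -- The cap `suc r` gives every vertex a radius; up to `r`, `Mixed-clash` keeps neighbours from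
  -- having equal radii.
  Stops : V H → ℕ → Set
  Stops x k = k ≡ suc r ⊎ Mixed k x

  Mixed-suc : ∀ {k x y} → Adj H x y → Mixed k x → Mixed (suc k) y
  Mixed-suc e (u , u′ , w , w′ , u≢u′) = u , u′ , cons (sym-H e) w , cons (sym-H e) w′ , u≢u′

  -- Back along the first walk, across the edge and along the second is a walk of length `2k + 1`,
  -- which is padded to `2r + 1`.
  ends-differ : ∀ {k x y u v} → k ≤ r → Adj H x y → Walk H k x u → Walk H k y v → c u ≢ c v
  ends-differ {k} k≤r e w w′ with m≤n⇒∃[o]m+o≡n k≤r
  ... | i , refl = proper _ _ (castʷ (lengths i k) (padʷ sym-H i (castʷ (+-suc k k) (reverseʷ sym-H w ++ʷ cons e w′))))
    where
    lengths : ∀ i k → i + i + suc (k + k) ≡ suc (2 * (k + i))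
    lengths = solveℕ-∀

  -- The two colours seen from `x` and the two seen from `y` have one in common, against
  -- `ends-differ`.
  Mixed-clash : ∀ {k x y} → k ≤ r → Adj H x y → Mixed k x → ¬ Mixed k y
  Mixed-clash k≤r e (u , u′ , w , w′ , u≢u′) (v , v′ , z , z′ , v≢v′) with three-colours (c u) (c u′) (c v) (c v′)
  ... | inj₁ eq = u≢u′ eq
  ... | inj₂ (inj₁ eq) = v≢v′ eq
  ... | inj₂ (inj₂ (inj₁ (inj₁ eq))) = ends-differ k≤r e w z eq
  ... | inj₂ (inj₂ (inj₁ (inj₂ eq))) = ends-differ k≤r e w z′ eq
  ... | inj₂ (inj₂ (inj₂ (inj₁ eq))) = ends-differ k≤r e w′ z eq
  ... | inj₂ (inj₂ (inj₂ (inj₂ eq))) = ends-differ k≤r e w′ z′ eq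

  adj-differ : ∀ {x y} → Adj H x y → c x ≢ c y
  adj-differ e = ends-differ z≤n e nil nil

  Turn : Bool → Fin 3 → Fin 3 → Set
  Turn true  α β = β ≡ next α
  Turn false α β = α ≡ next β

  -- `up` tells on which side of `c x` the colour of the neighbours lies. At radius 1 the neighbours
  -- may have both other colours, so `turn` speaks only from radius 2 on.
  record Position (x : V H) : Set where
    field
      radius offset : ℕ
      up            : Bool
      stops         : Stops x radius
      first         : ∀ j → j < radius → ¬ Stops x j
      has-offset    : HasOffset r radius offset
      turn          : 2 ≤ radius → ∀ {y} → Adj H x y → Turn up (c x) (c y)

    radius≤ : radius ≤ suc r
    radius≤ = ≮⇒≥ λ lt → first (suc r) lt (inj₁ refl)

    1≤radius : 1 ≤ radius
    1≤radius = positive radius stops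
      where
      positive : ∀ k → Stops x k → 1 ≤ k
      positive (suc k) _ = s≤s z≤n
      positive zero (inj₂ (_ , _ , nil , nil , x≢x)) = contradiction refl x≢x

    offset≤r : offset ≤ r
    offset≤r = offset≤ 1≤radius radius≤ has-offset

    -- Centres of different arcs are a third of the circle apart, less than a half; the point
    -- therefore recedes from the arc of its neighbours.
    shift : Bool → ℕ
    shift true  = r ∸ offset
    shift false = r + offset

    value : ℕ
    value = toℕ (c x) * suc (2 * r) + shift up

    shift≤ : ∀ b → shift b ≤ 2 * r
    shift≤ true  = ≤-trans (m∸n≤m r offset) (m≤m+n r _)
    shift≤ false = +-monoʳ-≤ r (≤-trans offset≤r (m≤m+n r 0))

    value< : value < 3 * suc (2 * r)
    value< = begin-strict
      toℕ (c x) * suc (2 * r) + shift up <⟨ +-mono-≤-< (*-monoˡ-≤ (suc (2 * r)) (toℕ≤pred[n] (c x))) (s≤s (shift≤ up)) ⟩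
      2 * suc (2 * r) + suc (2 * r)      ≡⟨ +-comm (2 * suc (2 * r)) _ ⟩
      3 * suc (2 * r)                    ∎
      where open ≤-Reasoning

    -- With radius 1 the offset vanishes, so that the direction does not matter.
    shift-towards : ∀ {y b} → Adj H x y → Turn b (c x) (c y) → shift up ≡ shift b
    shift-towards {y} {b} e t with 2 ≤? radius
    ... | yes 2≤k = same up b (turn 2≤k e) t
      where
      same : ∀ a b → Turn a (c x) (c y) → Turn b (c x) (c y) → shift a ≡ shift b
      same true  true  _ _ = refl
      same false false _ _ = refl
      same true  false t t′ = contradiction (trans t′ (cong next t)) (next-asym (c x))
      same false true  t t′ = contradiction (trans t (cong next t′)) (next-asym (c x))
    ... | no k<2 = trans (centre up) (sym (centre b))
      where
      offset≡0 : offset ≡ 0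
      offset≡0 = offset-one (subst (λ k → HasOffset r k offset) (≤-antisym (≤-pred (≰⇒> k<2)) 1≤radius) has-offset)
      centre : ∀ b → shift b ≡ r
      centre true  = cong (r ∸_) offset≡0
      centre false = trans (cong (λ z → r + z) offset≡0) (+-identityʳ r)

  open Position

  ¬¬-position : ∀ x → ¬ ¬ Position x
  ¬¬-position x no-pos =
    ¬¬-least {P = Stops x} (inj₁ refl) λ (k , stops-k , first-k) →
    ¬¬-excluded-middle {A = ∃[ y ] (Adj H x y × c y ≡ next (c x))} λ d →
    let k≤ = ≮⇒≥ λ lt → first-k (suc r) lt (inj₁ refl)
        q , off = offset-exists k≤
        b , t = direction k first-k d
    in no-pos record { radius = k ; offset = q ; up = b ; stops = stops-k ; first = first-k ; has-offset = off ; turn = t }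
    where
    direction : ∀ k → (∀ j → j < k → ¬ Stops x j) → Dec (∃[ y ] (Adj H x y × c y ≡ next (c x))) →
                ∃[ b ] (2 ≤ k → ∀ {y} → Adj H x y → Turn b (c x) (c y))
    -- Since 1 is below the radius, no two neighbours differ in colour, and `y` decides for all of
    -- them.
    direction k first-k (yes (y , e , eq)) = true , λ 2≤k {y′} e′ →
      trans (decidable-stable (c y′ ≟ᶠ c y) λ differ →
        first-k 1 2≤k (inj₂ (y′ , y , cons e′ nil , cons e nil , differ))) eq
    direction k first-k (no none) = false , λ _ {y} e → case-connex e (next-connex (c x) (c y))
      where
      case-connex : ∀ {y} → Adj H x y → c x ≡ c y ⊎ c y ≡ next (c x) ⊎ c x ≡ next (c y) → c x ≡ next (c y)
      case-connex e (inj₁ eq) = contradiction eq (adj-differ e)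
      case-connex {y} e (inj₂ (inj₁ eq)) = contradiction (y , e , eq) none
      case-connex e (inj₂ (inj₂ eq)) = eq

  -- Two colours reached from `x` in `k` steps are reached from `y` in `suc k`.
  radius-suc : ∀ {x y} → Adj H x y → (p : Position x) (p′ : Position y) → radius p < radius p′ → radius p′ ≡ suc (radius p)
  radius-suc e p p′ lt = ≤-antisym (≮⇒≥ (λ lt′ → early lt′ (stops p))) lt
    where
    early : suc (radius p) < radius p′ → ¬ Stops _ (radius p)
    early lt′ (inj₁ eq) = <⇒≱ lt (subst (radius p′ ≤_) (sym eq) (radius≤ p′))
    early lt′ (inj₂ mixed) = first p′ _ lt′ (inj₂ (Mixed-suc e mixed))

  -- Neighbouring radii are consecutive by `radius-suc`, or equal; if equal they are both `suc r`,
  -- by `Mixed-clash`.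
  offset-sum : ∀ {x y} → Adj H x y → (p : Position x) (p′ : Position y) →
               offset p + offset p′ ≡ r ⊎ offset p + offset p′ ≡ suc r
  offset-sum e p p′ with <-cmp (radius p) (radius p′)
  ... | tri< lt _ _ = offset-sum-suc {q = offset p} {offset p′} (has-offset p)
        (subst (λ k → HasOffset r k (offset p′)) (radius-suc e p p′ lt) (has-offset p′))
  ... | tri> _ _ gt = subst (λ s → s ≡ r ⊎ s ≡ suc r) (+-comm (offset p′) (offset p))
        (offset-sum-suc {q = offset p′} {offset p} (has-offset p′)
          (subst (λ k → HasOffset r k (offset p)) (radius-suc (sym-H e) p′ p gt) (has-offset p)))
  ... | tri≈ _ same _ with radius p ≟ suc r
  ... | yes top = offset-sum-top {q = offset p} {offset p′}
        (subst (λ k → HasOffset r k (offset p)) top (has-offset p))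
        (subst (λ k → HasOffset r k (offset p′)) (trans (sym same) top) (has-offset p′))
  ... | no below = ⊥-elim (Mixed-clash (≤-pred (≤∧≢⇒< (radius≤ p) below)) e (mixed (stops p) below)
                    (subst (λ k → Mixed k _) (sym same) (mixed (stops p′) (λ eq → below (trans same eq)))))
    where
    mixed : ∀ {x k} → Stops x k → k ≢ suc r → Mixed k x
    mixed (inj₁ eq) k≢ = contradiction eq k≢
    mixed (inj₂ m)  _  = m

  near-adj : ∀ {x y} → Adj H x y → (p : Position x) (p′ : Position y) →
             Near (3 * suc (2 * r)) 1 1 (+ (2 * value p)) (+ (2 * value p′))
  near-adj {x} {y} e p p′ = orient (next-connex (c x) (c y))
    where
    ascending : ∀ {x y} → Adj H x y → (p : Position x) (p′ : Position y) → c y ≡ next (c x) →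
                Near (3 * suc (2 * r)) 1 1 (+ (2 * value p)) (+ (2 * value p′))
    ascending {x} {y} e p p′ eq = near-ascending r (c x) below above (offset-sum e p p′)
      where
      below : value p + offset p ≡ toℕ (c x) * suc (2 * r) + r
      below = trans (+-assoc (toℕ (c x) * suc (2 * r)) _ _)
        (cong (λ z → toℕ (c x) * suc (2 * r) + z) (trans (cong (_+ offset p) (shift-towards p {b = true} e eq)) (m∸n+n≡m (offset≤r p))))
      above : value p′ ≡ toℕ (next (c x)) * suc (2 * r) + (r + offset p′)
      above = cong₂ (λ α s → toℕ α * suc (2 * r) + s) eq (shift-towards p′ {b = false} (sym-H e) eq)
    orient : c x ≡ c y ⊎ c y ≡ next (c x) ⊎ c x ≡ next (c y) →
             Near (3 * suc (2 * r)) 1 1 (+ (2 * value p)) (+ (2 * value p′))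
    orient (inj₁ eq) = contradiction eq (adj-differ e)
    orient (inj₂ (inj₁ eq)) = ascending e p p′ eq
    orient (inj₂ (inj₂ eq)) = Near-sym (ascending (sym-H e) p′ p eq)

-- Fractional powers and circular cliques

CircK-sym : ∀ {N D} → Symmetric (CircK N D)
CircK-sym {N} {D} {i} {j} = subst (λ d → D ≤ d × d ≤ N ∸ D) (∣-∣-comm (toℕ i) (toℕ j))

module _ {n : ℕ} (G : SimpleGraph n) where

  subdiv-sym : ∀ {t} → Symmetric (Subdiv G t)
  subdiv-sym {x = inj₁ a} {inj₁ b} (t≡1 , e) = t≡1 , adj-sym G e
  subdiv-sym {x = inj₁ a} {inj₂ y} e = e
  subdiv-sym {x = inj₂ x} {inj₁ b} e = e
  subdiv-sym {x = inj₂ x} {inj₂ y} (eu≡ , ev≡ , step) =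
    sym eu≡ , sym ev≡ , [ inj₂ , inj₁ ]′ step

  subdivided-edge : ∀ u {a b} → toℕ a < toℕ b → E G a b ≡ true →
                    Walk (Subdiv G (suc u)) (suc u) (inj₁ a) (inj₁ b)
  subdivided-edge zero    lt e = cons (refl , e) nil
  subdivided-edge (suc u) {a} {b} lt e = cons (inj₁ (refl , refl)) (along u zero refl)
    where
    along : ∀ k (i : Fin (suc u)) → toℕ i + suc k ≡ suc u →
            Walk (Subdiv G (suc (suc u))) (suc k) (inj₂ (inner a b lt e i)) (inj₁ b)
    along zero i eq = cons (inj₂ (refl , trans (+-comm 1 (toℕ i)) eq)) nil
    along (suc k) i eq =
      cons (refl , refl , inj₁ (sym (toℕ-fromℕ< i+1<)))
           (along k (fromℕ< i+1<) (trans (cong (_+ suc k) (toℕ-fromℕ< i+1<)) eq′))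
      where
      eq′ : suc (toℕ i) + suc k ≡ suc u
      eq′ = trans (sym (+-suc (toℕ i) (suc k))) eq
      i+1< : suc (toℕ i) < suc u
      i+1< = subst (suc (toℕ i) <_) eq′ (m<m+n (suc (toℕ i)) (s≤s z≤n))

  -- Needed because the subdivision stores each edge as an increasing pair.
  edge-wlog : (R : Fin n → Fin n → Set) → (∀ a b → R a b → R b a) →
              (∀ {a b} → toℕ a < toℕ b → E G a b ≡ true → R a b) →
              ∀ a b → E G a b ≡ true → R a b
  edge-wlog R R-sym base a b e with <-cmp (toℕ a) (toℕ b)
  ... | tri< lt _ _ = base lt e
  ... | tri> _ _ gt = R-sym b a (base gt (adj-sym G e))
  ... | tri≈ _ eq _ = contradiction (trans (sym (irrefl G a)) (subst (λ v → E G a v ≡ true) (sym (toℕ-injective eq)) e)) λ ()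

-- `Near-far` is applied to both ways round the circle: the lift `0` bounds the arc `δ` from below,
-- the lift `-1` the complementary arc `ε`.
near⇒circular : ∀ {M D h v v′} → 2 * D + suc (2 * h) ≡ M → v ≤ v′ → v′ < M →
  Near M 1 (suc (2 * h)) (+ (2 * v)) (+ (2 * v′)) → D ≤ ∣ v - v′ ∣ × ∣ v - v′ ∣ ≤ M ∸ D
near⇒circular {M} {D} {h} {v} M≡ v≤v′ v′< near-v with m≤n⇒∃[o]m+o≡n v≤v′
... | δ , refl with m≤n⇒∃[o]m+o≡n (≤-trans (m≤n+m δ v) (<⇒≤ v′<))
... | ε , refl = subst (λ d → D ≤ d × d ≤ δ + ε ∸ D) (sym (∣m-m+n∣≡n v δ))
    ( conclude (subst (λ z → δ + ε ≤ z + suc (2 * h) * 1) (cong ∣_∣ forward) (Near-far {h = h} (+ 0) near-v))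
    , m+n≤o⇒m≤o∸n δ (+-monoʳ-≤ δ (conclude
        (subst (λ z → δ + ε ≤ z + suc (2 * h) * 1) (trans (cong ∣_∣ backward) (ℤ.∣-i∣≡∣i∣ (+ (2 * ε))))
          (Near-far {h = h} ℤ.-[1+ 0 ] near-v)))) )
  where
  conclude : ∀ {x} → δ + ε ≤ 2 * x + suc (2 * h) * 1 → D ≤ x
  conclude {x} le = *-cancelˡ-≤ 2 (+-cancelʳ-≤ (suc (2 * h)) (2 * D) (2 * x)
    (subst₂ _≤_ (sym M≡) (cong (λ z → 2 * x + z) (*-identityʳ (suc (2 * h)))) le))
  forward-ℤ : ∀ v δ ε → + 2 ℤ.* (v ℤ.+ δ) ℤ.- + 2 ℤ.* v ℤ.+ + 2 ℤ.* (δ ℤ.+ ε) ℤ.* + 0 ≡ + 2 ℤ.* δ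
  forward-ℤ = solve-∀
  backward-ℤ : ∀ v δ ε → + 2 ℤ.* (v ℤ.+ δ) ℤ.- + 2 ℤ.* v ℤ.+ + 2 ℤ.* (δ ℤ.+ ε) ℤ.* ℤ.-[1+ 0 ] ≡ ℤ.- (+ 2 ℤ.* ε)
  backward-ℤ = solve-∀
  cast : ∀ z → + (2 * (v + δ)) ℤ.- + (2 * v) ℤ.+ + (2 * (δ + ε)) ℤ.* z ≡
               + 2 ℤ.* (+ v ℤ.+ + δ) ℤ.- + 2 ℤ.* + v ℤ.+ + 2 ℤ.* (+ δ ℤ.+ + ε) ℤ.* z
  cast z = cong₂ (λ a b → a ℤ.+ b ℤ.* z) (cong₂ ℤ._-_ (ℤ.pos-* 2 (v + δ)) (ℤ.pos-* 2 v)) (ℤ.pos-* 2 (δ + ε))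
  forward : + (2 * (v + δ)) ℤ.- + (2 * v) ℤ.+ + (2 * (δ + ε)) ℤ.* + 0 ≡ + (2 * δ)
  forward = trans (cast (+ 0)) (trans (forward-ℤ (+ v) (+ δ) (+ ε)) (sym (ℤ.pos-* 2 δ)))
  backward : + (2 * (v + δ)) ℤ.- + (2 * v) ℤ.+ + (2 * (δ + ε)) ℤ.* ℤ.-[1+ 0 ] ≡ ℤ.- + (2 * ε)
  backward = trans (cast ℤ.-[1+ 0 ]) (trans (backward-ℤ (+ v) (+ δ) (+ ε)) (cong ℤ.-_ (sym (ℤ.pos-* 2 ε))))

-- An edge of `G` is a walk of `2s + 1` steps in the subdivision, each with error at most 1 on the
-- doubled circle. This fits the clique with `N - 2D = 2s + 1`.
fracPow-3-colouring⇒circular : ∀ {n} (G : SimpleGraph n) r s {D} → s + D ≡ suc (3 * r) →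
  Colourable (FracPow G r s) 3 → ¬ ¬ Hom (toGraph G) (CircK (3 * suc (2 * r)) D)
fracPow-3-colouring⇒circular {n} G r s {D} s+D≡ (c , proper) no-hom =
  -- Positions are fixed only at the original vertices; `near-walk` supplies those of inner vertices
  -- along each walk.
  ¬¬-finite-choice (λ a → ¬¬-position H-sym r c proper (inj₁ a)) λ pos →
  no-hom ((λ a → fromℕ< (value< (pos a))) ,
    edge-wlog G (λ a b → Adj (CircK N D) (fromℕ< (value< (pos a))) (fromℕ< (value< (pos b))))
      (λ a b → CircK-sym {N} {D} {fromℕ< (value< (pos a))} {fromℕ< (value< (pos b))})
      λ {a} {b} lt e → subst₂ (λ i j → D ≤ ∣ i - j ∣ × ∣ i - j ∣ ≤ N ∸ D)
        (sym (toℕ-fromℕ< (value< (pos a)))) (sym (toℕ-fromℕ< (value< (pos b))))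
        (adjacent (pos a) (pos b) (subdivided-edge G (2 * s) lt e)))
  where
  N = 3 * suc (2 * r)
  H = Subdiv G (suc (2 * s))
  H-sym : Symmetric H
  H-sym {x} {y} = subdiv-sym G {x = x} {y}
  Pos = Position H-sym r c proper
  open Position
  N≡ : 2 * D + suc (2 * s) ≡ N
  N≡ = trans (regroup D s) (trans (cong (λ z → suc (2 * z)) s+D≡) (expand r))
    where
    regroup : ∀ D s → 2 * D + suc (2 * s) ≡ suc (2 * (s + D))
    regroup = solveℕ-∀
    expand : ∀ r → suc (2 * suc (3 * r)) ≡ 3 * suc (2 * r)
    expand = solveℕ-∀
  adjacent : ∀ {x y} (p : Pos x) (q : Pos y) → Walk H (suc (2 * s)) x y →
             D ≤ ∣ value p - value q ∣ × ∣ value p - value q ∣ ≤ N ∸ D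
  adjacent p q w = decidable-stable ((D ≤? _) ×-dec (_ ≤? N ∸ D)) λ not-adj →
    near-walk Pos (λ p → + (2 * value p)) (¬¬-position H-sym r c proper) (near-adj H-sym r c proper) w p q
    λ near-pq → not-adj (either near-pq (≤-total (value p) (value q)))
    where
    either : Near N 1 (suc (2 * s)) (+ (2 * value p)) (+ (2 * value q)) → value p ≤ value q ⊎ value q ≤ value p →
             D ≤ ∣ value p - value q ∣ × ∣ value p - value q ∣ ≤ N ∸ D
    either near-pq (inj₁ le) = near⇒circular {h = s} N≡ le (value< q) near-pq
    either near-pq (inj₂ ge) = subst (λ d → D ≤ d × d ≤ N ∸ D) (∣-∣-comm (value q) (value p))
                                 (near⇒circular {h = s} N≡ ge (value< p) (Near-sym near-pq))

-- From homomorphisms to circular cliques to 3-colourings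

∣pos-pos∣< : ∀ {a b K} → a < K → b < K → ∣ + a ℤ.- + b ∣ < K
∣pos-pos∣< {a} {b} a< b< with ≤-total a b
... | inj₁ a≤b = ≤-<-trans (≤-trans (≤-reflexive (trans (cong ∣_∣ (ℤ.[+m]-[+n]≡m⊖n a b)) (ℤ.∣⊖∣-≤ a≤b))) (m∸n≤m b a)) b<
... | inj₂ b≤a = ≤-<-trans (≤-trans (≤-reflexive (trans (cong ∣_∣ (ℤ.[+m]-[+n]≡m⊖n a b)) (trans (ℤ.∣m⊖n∣≡∣n⊖m∣ a b) (ℤ.∣⊖∣-≤ b≤a)))) (m∸n≤m a b)) a<

/-≡⇒∣-∣< : ∀ u v K .{{_ : NonZero K}} → u / K ≡ v / K → ∣ + v ℤ.- + u ∣ < K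
/-≡⇒∣-∣< u v K eq = subst (_< K) (cong ∣_∣ (sym difference)) (∣pos-pos∣< (m%n<n v K) (m%n<n u K))
  where
  cancel : ∀ a b q → (a ℤ.+ q) ℤ.- (b ℤ.+ q) ≡ a ℤ.- b
  cancel = solve-∀
  difference : + v ℤ.- + u ≡ + (v % K) ℤ.- + (u % K)
  difference = trans
    (cong₂ (λ a b → + a ℤ.- + b) (m≡m%n+[m/n]*n v K) (trans (m≡m%n+[m/n]*n u K) (cong (λ q → u % K + q * K) eq)))
    (cancel (+ (v % K)) (+ (u % K)) (+ (v / K * K)))

-- Write the distance as `D + i` with `i + j = c`; twice it, minus `2D + c`, is `i - j`.
circular⇒near-antipodal : ∀ {D c x y} → x ≤ y → D ≤ ∣ x - y ∣ → ∣ x - y ∣ ≤ 2 * D + c ∸ D →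
  ∣ + 2 ℤ.* (+ y ℤ.- + x) ℤ.- + (2 * D + c) ∣ ≤ c
circular⇒near-antipodal {D} {c} {x} x≤y lower upper with m≤n⇒∃[o]m+o≡n x≤y
... | δ , refl with m≤n⇒∃[o]m+o≡n (subst (D ≤_) (∣m-m+n∣≡n x δ) lower)
... | i , refl with m≤n⇒∃[o]m+o≡n {i} {c} (+-cancelˡ-≤ D i c (subst₂ _≤_ (∣m-m+n∣≡n x (D + i)) D+c≡ upper))
  where
  D+c≡ : 2 * D + c ∸ D ≡ D + c
  D+c≡ = trans (cong (_∸ D) (trans (cong (_+ c) (2*-as-sum D)) (+-assoc D D c))) (m+n∸m≡n D (D + c))
... | j , refl = subst (_≤ i + j) (cong ∣_∣ (sym difference)) (ℤ.∣i-j∣≤∣i∣+∣j∣ (+ i) (+ j))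
  where
  cancel : ∀ x D i j → + 2 ℤ.* ((x ℤ.+ (D ℤ.+ i)) ℤ.- x) ℤ.- (+ 2 ℤ.* D ℤ.+ (i ℤ.+ j)) ≡ i ℤ.- j
  cancel = solve-∀
  difference : + 2 ℤ.* (+ (x + (D + i)) ℤ.- + x) ℤ.- + (2 * D + (i + j)) ≡ + i ℤ.- + j
  difference = trans (cong (λ z → + 2 ℤ.* (+ (x + (D + i)) ℤ.- + x) ℤ.- (z ℤ.+ + (i + j))) (ℤ.pos-* 2 D))
                     (cancel (+ x) (+ D) (+ i) (+ j))

module _ {n : ℕ} (G : SimpleGraph n) {D c : ℕ} (1≤D : 1 ≤ D)
         (hom : Hom (toGraph G) (CircK (2 * D + c) D))
         (r s : ℕ) (1≤s : 1 ≤ s) (small : suc (2 * r) * (3 * c) ≤ suc (2 * s) * (2 * D + c)) where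

  private
    -- In units of `1 / (6 t)` the circle has length `6 * B`: `B` is a sixth of it and `K` a third.
    -- The hypothesis `small` says that `2r + 1` errors of `3 * c` amount to at most `B`.
    N t B K : ℕ
    N = 2 * D + c
    t = suc (2 * s)
    B = t * N
    K = 2 * B

    H : Graph
    H = Subdiv G t

    Nᶻ Sᶻ T : ℤ
    Nᶻ = + N
    Sᶻ = + s
    T  = + 1 ℤ.+ + 2 ℤ.* Sᶻ

    f : Fin n → Fin N
    f = proj₁ hom

    F : Fin n → ℤ
    F a = + toℕ (f a)

    -- The displacement from f a to f b is compared with N / 2 if f a ≤ f b, else with - N / 2.
    halfTurn : Fin n → Fin n → ℤ
    halfTurn a b with toℕ (f a) ≤? toℕ (f b)
    ... | yes _ = + 0
    ... | no  _ = ℤ.-[1+ 0 ]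

    -- In units of 1 / (6 t): a half turn plus the t-th part of the deviation of f b from
    -- the antipode of f a.  As t is odd, t such steps lead to f b up to full turns.
    step : Fin n → Fin n → ℤ
    step a b = + 6 ℤ.* Nᶻ ℤ.* Sᶻ ℤ.* (+ 2 ℤ.* halfTurn a b ℤ.+ + 1) ℤ.+ + 6 ℤ.* (F b ℤ.- F a)

    position : V H → ℤ
    position (inj₁ a) = + 6 ℤ.* T ℤ.* F a
    position (inj₂ x) = + 6 ℤ.* T ℤ.* F (eu x) ℤ.+ + suc (toℕ (pos x)) ℤ.* step (eu x) (ev x)

    3B≡ : + (3 * B) ≡ + 3 ℤ.* (T ℤ.* Nᶻ)
    3B≡ = trans (ℤ.pos-* 3 B) (cong (+ 3 ℤ.*_) (trans (ℤ.pos-* t N) (cong (λ z → (+ 1 ℤ.+ z) ℤ.* Nᶻ) (ℤ.pos-* 2 s))))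

    deviation : Fin n → Fin n → ℤ
    deviation a b = + 3 ℤ.* (+ 2 ℤ.* (F b ℤ.- F a) ℤ.- Nᶻ ℤ.* (+ 2 ℤ.* halfTurn a b ℤ.+ + 1))

    deviation≤ : ∀ a b → E G a b ≡ true → ∣ deviation a b ∣ ≤ 3 * c
    deviation≤ a b e with proj₂ hom a b e | toℕ (f a) ≤? toℕ (f b)
    ... | lower , upper | yes le = subst (_≤ 3 * c)
      (trans (sym (ℤ.∣i*j∣≡∣i∣*∣j∣ (+ 3) z)) (cong ∣_∣ (same (F b ℤ.- F a) Nᶻ)))
      (*-monoʳ-≤ 3 (circular⇒near-antipodal le lower upper))
      where
      z = + 2 ℤ.* (F b ℤ.- F a) ℤ.- Nᶻ
      same : ∀ d N → + 3 ℤ.* (+ 2 ℤ.* d ℤ.- N) ≡ + 3 ℤ.* (+ 2 ℤ.* d ℤ.- N ℤ.* (+ 2 ℤ.* + 0 ℤ.+ + 1))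
      same = solve-∀
    ... | lower , upper | no gt = subst (_≤ 3 * c)
      (trans (sym (ℤ.∣i*j∣≡∣i∣*∣j∣ ℤ.-[1+ 2 ] z)) (cong ∣_∣ (negated (F a) (F b) Nᶻ)))
      (*-monoʳ-≤ 3 (circular⇒near-antipodal (<⇒≤ (≰⇒> gt))
        (subst (D ≤_) (∣-∣-comm (toℕ (f a)) _) lower) (subst (_≤ N ∸ D) (∣-∣-comm (toℕ (f a)) _) upper)))
      where
      z = + 2 ℤ.* (F a ℤ.- F b) ℤ.- Nᶻ
      negated : ∀ a b N → ℤ.-[1+ 2 ] ℤ.* (+ 2 ℤ.* (a ℤ.- b) ℤ.- N) ≡
                + 3 ℤ.* (+ 2 ℤ.* (b ℤ.- a) ℤ.- N ℤ.* (+ 2 ℤ.* ℤ.-[1+ 0 ] ℤ.+ + 1))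
      negated = solve-∀

    near-step : ∀ {a b x y} k → E G a b ≡ true →
                y ℤ.- x ≡ step a b ℤ.+ + 3 ℤ.* (T ℤ.* Nᶻ) ℤ.* (+ 2 ℤ.* k) → Near (3 * B) (3 * c) 1 x y
    near-step {a} {b} k e eq = near (halfTurn a b ℤ.+ k) (deviation a b)
      (trans eq (trans (regroup Nᶻ Sᶻ (halfTurn a b) (F b ℤ.- F a) k)
        (cong (λ z → z ℤ.* (+ 2 ℤ.* (halfTurn a b ℤ.+ k) ℤ.+ + 1) ℤ.+ deviation a b) (sym 3B≡))))
      (≤-trans (deviation≤ a b e) (≤-reflexive (sym (*-identityˡ (3 * c)))))
      where
      regroup : ∀ N S o d k →
        + 6 ℤ.* N ℤ.* S ℤ.* (+ 2 ℤ.* o ℤ.+ + 1) ℤ.+ + 6 ℤ.* d ℤ.+ + 3 ℤ.* ((+ 1 ℤ.+ + 2 ℤ.* S) ℤ.* N) ℤ.* (+ 2 ℤ.* k) ≡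
        + 3 ℤ.* ((+ 1 ℤ.+ + 2 ℤ.* S) ℤ.* N) ℤ.* (+ 2 ℤ.* (o ℤ.+ k) ℤ.+ + 1) ℤ.+
        + 3 ℤ.* (+ 2 ℤ.* d ℤ.- N ℤ.* (+ 2 ℤ.* o ℤ.+ + 1))
      regroup = solve-∀

    near-end : ∀ a (x : Inner G t) → EndAdj a x → Near (3 * B) (3 * c) 1 (position (inj₁ a)) (position (inj₂ x))
    near-end a x (inj₁ (refl , p≡0)) = near-step (+ 0) (isE x)
      (trans (cong (λ p → (+ 6 ℤ.* T ℤ.* F a ℤ.+ + suc p ℤ.* step a (ev x)) ℤ.- + 6 ℤ.* T ℤ.* F a) p≡0)
             (first-step (+ 6 ℤ.* T ℤ.* F a) (step a (ev x)) (+ 3 ℤ.* (T ℤ.* Nᶻ))))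
      where
      first-step : ∀ z w M → (z ℤ.+ + 1 ℤ.* w) ℤ.- z ≡ w ℤ.+ M ℤ.* (+ 2 ℤ.* + 0)
      first-step = solve-∀
    -- All `t` steps together lead `s * (2 * halfTurn a b + 1)` full turns beyond the lift of `F b`;
    -- the last step takes them back.
    near-end b x (inj₂ (refl , p≡)) = Near-sym (near-step (ℤ.- (Sᶻ ℤ.* (+ 2 ℤ.* halfTurn a b ℤ.+ + 1))) (isE x)
      (trans (cong (λ p → + 6 ℤ.* T ℤ.* F b ℤ.- (+ 6 ℤ.* T ℤ.* F a ℤ.+ p ℤ.* step a b)) (trans (cong +_ p≡) (ℤ.pos-* 2 s)))
             (last-step Nᶻ Sᶻ (halfTurn a b) (F a) (F b))))
      where
      a = eu x
      last-step : ∀ N S o Fa Fb → 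
        + 6 ℤ.* (+ 1 ℤ.+ + 2 ℤ.* S) ℤ.* Fb ℤ.- (+ 6 ℤ.* (+ 1 ℤ.+ + 2 ℤ.* S) ℤ.* Fa ℤ.+ + 2 ℤ.* S ℤ.*
          (+ 6 ℤ.* N ℤ.* S ℤ.* (+ 2 ℤ.* o ℤ.+ + 1) ℤ.+ + 6 ℤ.* (Fb ℤ.- Fa))) ≡
        + 6 ℤ.* N ℤ.* S ℤ.* (+ 2 ℤ.* o ℤ.+ + 1) ℤ.+ + 6 ℤ.* (Fb ℤ.- Fa) ℤ.+
        + 3 ℤ.* ((+ 1 ℤ.+ + 2 ℤ.* S) ℤ.* N) ℤ.* (+ 2 ℤ.* ℤ.- (S ℤ.* (+ 2 ℤ.* o ℤ.+ + 1)))
      last-step = solve-∀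

    near-inner : ∀ (x y : Inner G t) → eu x ≡ eu y → ev x ≡ ev y → suc (toℕ (pos x)) ≡ toℕ (pos y) →
                 Near (3 * B) (3 * c) 1 (position (inj₂ x)) (position (inj₂ y))
    near-inner x y refl refl p≡ = near-step (+ 0) (isE x)
      (trans (cong (λ p → (z ℤ.+ + suc p ℤ.* w) ℤ.- (z ℤ.+ + suc (toℕ (pos x)) ℤ.* w)) (sym p≡))
             (one-step z w (+ suc (toℕ (pos x))) (+ 3 ℤ.* (T ℤ.* Nᶻ))))
      where
      z = + 6 ℤ.* T ℤ.* F (eu x)
      w = step (eu x) (ev x)
      one-step : ∀ z w p M → (z ℤ.+ (+ 1 ℤ.+ p) ℤ.* w) ℤ.- (z ℤ.+ p ℤ.* w) ≡ w ℤ.+ M ℤ.* (+ 2 ℤ.* + 0)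
      one-step = solve-∀

    near-subdiv : ∀ {x y} → Adj H x y → Near (3 * B) (3 * c) 1 (position x) (position y)
    near-subdiv {inj₁ a} {inj₁ b} (t≡1 , _) =
      contradiction (m*n≡0⇒m≡0 s 2 (trans (*-comm s 2) (suc-injective t≡1))) (λ s≡0 → <⇒≢ 1≤s (sym s≡0))
    near-subdiv {inj₁ a} {inj₂ y} e = near-end a y e
    near-subdiv {inj₂ x} {inj₁ b} e = Near-sym (near-end b x e)
    near-subdiv {inj₂ x} {inj₂ y} (eu≡ , ev≡ , inj₁ p≡) = near-inner x y eu≡ ev≡ p≡
    near-subdiv {inj₂ x} {inj₂ y} (eu≡ , ev≡ , inj₂ p≡) = Near-sym (near-inner y x (sym eu≡) (sym ev≡) p≡)

    instance
      B≢0 : NonZero B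
      B≢0 = >-nonZero (*-mono-≤ {1} {t} (s≤s z≤n) (≤-trans 1≤D (≤-trans (m≤m+n D _) (m≤m+n (2 * D) c))))
      K≢0 : NonZero K
      K≢0 = m*n≢0 2 B
      3K≢0 : NonZero (3 * K)
      3K≢0 = m*n≢0 3 K

    arc : V H → ℕ
    arc x = (position x ℤ.%ℕ (3 * K)) / K

    arc<3 : ∀ x → arc x < 3
    arc<3 x = m<n*o⇒m/o<n (ℤ.n%ℕd<d (position x) (3 * K))

    -- The ends are at least `3 * B - B = K` apart, whereas points of one arc are less than `K`
    -- apart.
    arcs-differ : ∀ {x y} → Walk H (suc (2 * r)) x y → arc x ≢ arc y
    arcs-differ {x} {y} w same =
      near-walk (λ _ → ⊤) (λ {x} _ → position x) (λ _ k → k tt) (λ e _ _ → near-subdiv e) w tt tt λ near-xy →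
      <-irrefl refl (begin-strict
        3 * B                                      ≤⟨ Near-far {h = r} (qx ℤ.- qy) near-xy ⟩
        ∣ position y ℤ.- position x ℤ.+ + (2 * (3 * B)) ℤ.* (qx ℤ.- qy) ∣ + suc (2 * r) * (3 * c)
                                                   ≡⟨ cong (λ z → ∣ z ∣ + suc (2 * r) * (3 * c)) reduced ⟩
        ∣ + uy ℤ.- + ux ∣ + suc (2 * r) * (3 * c) <⟨ +-mono-<-≤ (/-≡⇒∣-∣< ux uy K same) small ⟩
        K + B                                      ≡⟨ +-comm K B ⟩
        3 * B                                      ∎)
      where
      open ≤-Reasoning
      ux = position x ℤ.%ℕ (3 * K)
      uy = position y ℤ.%ℕ (3 * K)
      -- These quotients are the full turns lost by reducing positions; `Near-far` absorbs their
      -- difference.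
      qx = position x ℤ./ℕ (3 * K)
      qy = position y ℤ./ℕ (3 * K)
      cancel : ∀ a b p q L → (b ℤ.+ q ℤ.* L) ℤ.- (a ℤ.+ p ℤ.* L) ℤ.+ L ℤ.* (p ℤ.- q) ≡ b ℤ.- a
      cancel = solve-∀
      circumference : ∀ B → 2 * (3 * B) ≡ 3 * (2 * B)
      circumference = solveℕ-∀
      reduced : position y ℤ.- position x ℤ.+ + (2 * (3 * B)) ℤ.* (qx ℤ.- qy) ≡ + uy ℤ.- + ux
      reduced = trans
        (cong₂ (λ a b → a ℤ.+ b ℤ.* (qx ℤ.- qy))
          (cong₂ ℤ._-_ (ℤ.a≡a%ℕn+[a/ℕn]*n (position y) (3 * K)) (ℤ.a≡a%ℕn+[a/ℕn]*n (position x) (3 * K)))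
          (cong +_ (circumference B)))
        (cancel (+ ux) (+ uy) qx qy (+ (3 * K)))

  circular⇒fracPow-3-colouring : Colourable (FracPow G r s) 3
  circular⇒fracPow-3-colouring =
    (λ x → fromℕ< (arc<3 x)) , λ x y w same → arcs-differ w (fromℕ<-injective _ _ (arc<3 x) (arc<3 y) same)

-- The two implications

module _ {n : ℕ} (G : SimpleGraph n) (χ≡3 : ChromaticNumberIs (toGraph G) 3) where

  not-2-colourable : ¬ Colourable (toGraph G) 2
  not-2-colourable col = <⇒≱ (n<1+n 2) (proj₂ χ≡3 2 col)

  -- An odd girth is at least 3, so staying below the ratio 3 is enough.
  ThetaSet-intro : ∀ {r s} → Colourable (FracPow G r s) 3 → suc (2 * r) < 3 * suc (2 * s) → ¬ ¬ ThetaSet G r s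
  ThetaSet-intro {r} {s} col lt no-θ = ¬¬-oddGirth G not-2-colourable λ (g , girth) →
    no-θ ((3 , χ≡3 , col) , g , girth ,
      <-≤-trans lt (*-monoˡ-≤ (suc (2 * s)) (proj₁ (proj₁ (proj₂ girth)))))

  ThetaSet⇒3-colourable : ∀ r s → ThetaSet G r s → Colourable (FracPow G r s) 3
  ThetaSet⇒3-colourable r s ((k , (col-k , least-k) , col) , _) =
    subst (Colourable _) (≤-antisym (least-k 3 (proj₁ χ≡3)) (proj₂ χ≡3 k col-k)) col

  -- Puts the ratio 1 into the set, so that every upper bound is at least 1.
  first-power-colourable : Colourable (FracPow G 0 0) 3
  first-power-colourable = colour , proper
    where
    colour : Fin n ⊎ Inner G 1 → Fin 3
    colour (inj₁ a) = proj₁ (proj₁ χ≡3) a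
    proper : ∀ x y → Walk (Subdiv G 1) 1 x y → colour x ≢ colour y
    proper (inj₁ a) (inj₁ b) (cons (_ , e) nil) = proj₂ (proj₁ χ≡3) a b e

  θ≡1⇒χc≡3 : ThetaIs G 1 1 → CircChiIs (toGraph G) 3 1
  θ≡1⇒χc≡3 (upper , _) =
    (3 , 1 , s≤s z≤n , s≤s (s≤s z≤n) , refl , proj₁ (proj₁ χ≡3) , adjacent) , bound
    where
    adjacent : ∀ a b → E G a b ≡ true → Adj (CircK 3 1) (proj₁ (proj₁ χ≡3) a) (proj₁ (proj₁ χ≡3) b)
    adjacent a b e = distinct (proj₂ (proj₁ χ≡3) a b e)
      where
      distinct : ∀ {i j : Fin 3} → i ≢ j → Adj (CircK 3 1) i j
      distinct {i} {j} i≢j = n≢0⇒n>0 (λ eq → i≢j (toℕ-injective (∣m-n∣≡0⇒m≡n eq))) ,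
        ≤-trans (∣m-n∣≤m⊔n (toℕ i) (toℕ j)) (⊔-lub (toℕ≤pred[n] i) (toℕ≤pred[n] j))
    bound : ∀ N D → 1 ≤ D → 2 * D ≤ N → Hom (toGraph G) (CircK N D) → 3 * D ≤ N * 1
    bound N D 1≤D 2D≤N hom with m≤n⇒∃[o]m+o≡n 2D≤N
    -- If `N < 3D`, then `c < D`, and the ratio `(2s + 3) / (2s + 1)`, which exceeds 1, enters the
    -- set.
    ... | c , refl = subst (3 * D ≤_) (sym (*-identityʳ (2 * D + c))) (≮⇒≥ λ N<3D →
      let c<D = +-cancelˡ-< (2 * D) c D (subst (2 * D + c <_) (+-comm D (2 * D)) N<3D)
      in ThetaSet-intro {suc s} {s} (circular⇒fracPow-3-colouring G 1≤D hom (suc s) s (s≤s z≤n) (small c<D)) range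
        λ θ → <⇒≱ (s≤s (*-monoʳ-< 2 (n<1+n s)))
          (subst₂ _≤_ (*-identityʳ (suc (2 * suc s))) (*-identityˡ (suc (2 * s))) (upper (suc s) s θ)))
      where
      -- As `2D + c` is at least `3c + 2`, `small` holds once `3c` is at most `2s + 1`; this `s`
      -- achieves that and is positive.
      s = suc (2 * c)
      small : c < D → suc (2 * suc s) * (3 * c) ≤ suc (2 * s) * (2 * D + c)
      small c<D with m≤n⇒∃[o]m+o≡n c<D
      ... | i , refl = m+n≤o⇒m≤o _ (≤-reflexive (slack c i))
        where
        slack : ∀ c i → suc (2 * suc (suc (2 * c))) * (3 * c) + (2 * c + 6 + (8 * c + 6) * i) ≡ suc (2 * suc (2 * c)) * (2 * (suc c + i) + c)
        slack = solveℕ-∀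
      range : suc (2 * suc s) < 3 * suc (2 * s)
      range = m+n≤o⇒m≤o _ (≤-reflexive (slack c))
        where
        slack : ∀ c → suc (suc (2 * suc (suc (2 * c)))) + (8 * c + 3) ≡ 3 * suc (2 * suc (2 * c))
        slack = solveℕ-∀

  χc≡3⇒θ≡1 : CircChiIs (toGraph G) 3 1 → ThetaIs G 1 1
  χc≡3⇒θ≡1 (_ , minimal) = upper , least
    where
    upper : ∀ r s → ThetaSet G r s → suc (2 * r) * 1 ≤ 1 * suc (2 * s)
    upper r s θ = subst₂ _≤_ (sym (*-identityʳ (suc (2 * r)))) (sym (*-identityˡ (suc (2 * s))))
      (s≤s (*-monoʳ-≤ 2 (≮⇒≥ not-larger)))
      where
      not-larger : ¬ s < r
      not-larger s<r with m≤n⇒∃[o]m+o≡n s<r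
      ... | i , refl = fracPow-3-colouring⇒circular G r s (D≡ s i) (ThetaSet⇒3-colourable r s θ) λ hom →
        <⇒≱ (m+n≤o⇒m≤o _ (≤-reflexive (slack s i)))
          (minimal (3 * suc (2 * r)) D (s≤s z≤n) (m+n≤o⇒m≤o _ (≤-reflexive (slack′ s i))) hom)
        where
        -- This is `3r + 1 - s` for `r = s + 1 + i`; then `3D` exceeds `3 * (2r + 1)` by `3 + 3i`,
        -- against minimality of 3.
        D = suc (2 * s + 3 + 3 * i)
        D≡ : ∀ s i → s + suc (2 * s + 3 + 3 * i) ≡ suc (3 * (suc s + i))
        D≡ = solveℕ-∀
        slack : ∀ s i → suc (3 * suc (2 * (suc s + i)) * 1) + (2 + 3 * i) ≡ 3 * suc (2 * s + 3 + 3 * i)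
        slack = solveℕ-∀
        slack′ : ∀ s i → 2 * suc (2 * s + 3 + 3 * i) + (1 + 2 * s) ≡ 3 * suc (2 * (suc s + i))
        slack′ = solveℕ-∀
    least : ∀ a b → 1 ≤ b → (∀ r s → ThetaSet G r s → suc (2 * r) * b ≤ a * suc (2 * s)) → 1 * b ≤ a * 1
    least a b _ bound = decidable-stable (1 * b ≤? a * 1) λ not-le →
      ThetaSet-intro {0} {0} first-power-colourable (s≤s (s≤s z≤n)) (λ θ → not-le (bound 0 0 θ))

theorem4p3 : ∀ (n : ℕ) (G : SimpleGraph n) → ChromaticNumberIs (toGraph G) 3 →
    (ThetaIs G 1 1 → CircChiIs (toGraph G) 3 1) × (CircChiIs (toGraph G) 3 1 → ThetaIs G 1 1)
theorem4p3 n G χ≡3 = θ≡1⇒χc≡3 G χ≡3 , χc≡3⇒θ≡1 G χ≡3
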